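{- A connected graph $G$ satisfies $\mathrm{vp}^-(G) = 1$ if and only if $G$ is a path. The only connected graphs with $\mathrm{vp}(G) = 1$ are $K_1$ and $K_2$.
   Context: All graphs are finite, undirected and simple; the one-vertex graph counts as a path. A $u,v$-geodesic is a shortest $u,v$-path. For a vertex $x$ of $G$, a set $S \subseteq V(G)$ is an $x$-position set if for every $y \in S$ no vertex of $S \setminus \{y\}$ lies on any $x,y$-geodesic in $G$ (in particular $\{x\}$ is an $x$-position set). The $x$-position number $p_x(G)$ is the maximum cardinality of an $x$-position set of $G$. Define $\mathrm{vp}(G) = \max_{x \in V(G)} p_x(G)$ and $\mathrm{vp}^-(G) = \min_{x \in V(G)} p_x(G)$. -}

module Defs where

open import Data.Fin using (Fin; zero; toℕ)
open import Data.Fin.Properties using (all?; injective⇒≤) renaming (_≟_ to _≟ᶠ_)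
open import Data.Fin.Subset using (Subset; inside; outside; ∣_∣; _∈_)
open import Data.Fin.Subset.Properties using (_∈?_)
open import Data.List using (List; []; _∷_; _++_; map; filter; tabulate)
open import Data.List.Extrema.Nat using (max; min)
open import Data.Nat using (ℕ; zero; suc; _≤_; _<_)
open import Data.Nat.Properties
  using (_≟_; allUpTo?; <⇒≱; ≮⇒≥; 1+n≢n)
open import Data.Product using (_×_; _,_; proj₁; Σ-syntax; ∃-syntax)
open import Data.Sum using (_⊎_; inj₁; inj₂; swap; reduce)
open import Data.Vec as Vec using (Vec; head; last; lookup)
open import Data.Vec.Membership.DecPropositional using () renaming (_∈?_ to ∈ᵛ-dec)
open import Data.Vec.Membership.Propositional using () renaming (_∈_ to _∈ᵛ_)
open import Data.Vec.Relation.Unary.AllPairs using (allPairs?)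
open import Data.Vec.Relation.Unary.Linked using (Linked; linked?)
open import Data.Vec.Relation.Unary.Unique.Propositional using (Unique)
open import Data.Vec.Relation.Unary.Unique.Propositional.Properties using (lookup-injective)
open import Function using (_∘_; _⇔_; _↔_; Inverse)
open import Level using (0ℓ)
open import Relation.Binary using (Rel; Symmetric; Irreflexive) renaming (Decidable to Decidable₂)
open import Relation.Binary.PropositionalEquality using (_≡_; _≢_; refl; sym; ≢-sym)
open import Relation.Nullary using (¬_; Dec; ¬?; map′; _×-dec_; _→-dec_; _⊎-dec_)
open import Relation.Unary using (Pred; Decidable)

-- Adjacency is required to be decidable, as it is for a graph given by a
-- finite edge set.
record Graph (n : ℕ) : Set₁ where
  field
    _∼_      : Rel (Fin n) 0ℓ
    ∼-sym    : Symmetric _∼_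
    ∼-irrefl : Irreflexive _≡_ _∼_
    _∼?_     : Decidable₂ _∼_

all-vec? : ∀ {n} m {P : Pred (Vec (Fin n) m) 0ℓ} → Decidable P → Dec (∀ v → P v)
all-vec? zero    P? = map′ (λ { p Vec.[] → p }) (λ p → p Vec.[]) (P? Vec.[])
all-vec? (suc m) P? =
  map′ (λ { p (x Vec.∷ v) → p x v }) (λ p x v → p (x Vec.∷ v))
       (all? λ x → all-vec? m λ v → P? (x Vec.∷ v))

all<? : {P : Pred ℕ 0ℓ} → Decidable P → ∀ k → Dec (∀ l → l < k → P l)
all<? P? k = map′ (λ p l → p {l}) (λ p {l} → p l) (allUpTo? P? k)

module _ {n : ℕ} (G : Graph n) where
  open Graph G

  -- The number of vertices is suc k, so the path has length k.
  IsPath : ∀ {k} → Fin n → Fin n → Vec (Fin n) (suc k) → Set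
  IsPath x y v = head v ≡ x × last v ≡ y × Linked _∼_ v × Unique v

  Connected : Set
  Connected = ∀ x y → ∃[ k ] Σ[ v ∈ Vec (Fin n) (suc k) ] IsPath x y v

  IsGeodesic : ∀ {k} → Fin n → Fin n → Vec (Fin n) (suc k) → Set
  IsGeodesic {k} x y v =
    IsPath x y v × (∀ {l} (w : Vec (Fin n) (suc l)) → IsPath x y w → k ≤ l)

  IsPositionSet : Fin n → Subset n → Set
  IsPositionSet x S =
    ∀ y → y ∈ S → ∀ z → z ∈ S → z ≢ y →
    ∀ {k} (v : Vec (Fin n) (suc k)) → IsGeodesic x y v → ¬ z ∈ᵛ v

  isPath? : ∀ {k} x y (v : Vec (Fin n) (suc k)) → Dec (IsPath x y v)
  isPath? x y v =
    head v ≟ᶠ x ×-dec last v ≟ᶠ y ×-dec linked? _∼?_ v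
      ×-dec allPairs? (λ a b → ¬? (a ≟ᶠ b)) v

  path-length< : ∀ {k x y} (v : Vec (Fin n) (suc k)) → IsPath x y v → k < n
  path-length< v (_ , _ , _ , u) = injective⇒≤ {f = lookup v} (lookup-injective u _ _)

  isGeodesic? : ∀ {k} x y (v : Vec (Fin n) (suc k)) → Dec (IsGeodesic x y v)
  isGeodesic? {k} x y v = isPath? x y v ×-dec
    map′ (λ none w p → ≮⇒≥ λ l<k → none _ l<k w p)
         (λ least _ l<k w p → <⇒≱ l<k (least w p))
         (all<? (λ l → all-vec? (suc l) λ w → ¬? (isPath? x y w)) k)

  isPositionSet? : ∀ x → Decidable (IsPositionSet x)
  isPositionSet? x S =
    all? λ y → (y ∈? S) →-dec all? λ z → (z ∈? S) →-dec ¬? (z ≟ᶠ y) →-dec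
      map′ (λ h v g → h _ (path-length< v (proj₁ g)) v g) (λ h _ _ v → h v)
           (all<? (λ k → all-vec? (suc k) λ v →
              isGeodesic? x y v →-dec ¬? (∈ᵛ-dec _≟ᶠ_ z v)) n)

subsets : ∀ n → List (Subset n)
subsets zero    = Vec.[] ∷ []
subsets (suc n) = map (inside Vec.∷_) (subsets n) ++ map (outside Vec.∷_) (subsets n)

-- The default value 0 is the size of the empty set, which is a position set.
positionNumber : ∀ {n} → Graph n → Fin n → ℕ
positionNumber {n} G x = max 0 (map ∣_∣ (filter (isPositionSet? G x) (subsets n)))

-- The library's max and min over a list take a default value as first
-- argument; here it is itself one of the position numbers.
vp : ∀ {n} → Graph (suc n) → ℕ
vp G = max (positionNumber G zero) (tabulate (positionNumber G))

vp⁻ : ∀ {n} → Graph (suc n) → ℕ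
vp⁻ G = min (positionNumber G zero) (tabulate (positionNumber G))

infix 4 _≅_
_≅_ : ∀ {m n} → Graph m → Graph n → Set
_≅_ {m} {n} G H =
  Σ[ f ∈ Fin m ↔ Fin n ] (∀ x y → (Graph._∼_ G x y ⇔ Graph._∼_ H (Inverse.to f x) (Inverse.to f y)))

pathGraph : ∀ n → Graph n
pathGraph n = record
  { _∼_      = λ i j → toℕ j ≡ suc (toℕ i) ⊎ toℕ i ≡ suc (toℕ j)
  ; ∼-sym    = swap
  ; ∼-irrefl = λ { refl → 1+n≢n ∘ sym ∘ reduce }
  ; _∼?_     = λ i j → (toℕ j ≟ suc (toℕ i)) ⊎-dec (toℕ i ≟ suc (toℕ j))
  }

completeGraph : ∀ n → Graph n
completeGraph n = record
  { _∼_      = _≢_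
  ; ∼-sym    = ≢-sym
  ; ∼-irrefl = λ eq neq → neq eq
  ; _∼?_     = λ i j → ¬? (i ≟ᶠ j)
  }

IsPathGraph : ∀ {n} → Graph n → Set
IsPathGraph G = ∃[ k ] G ≅ pathGraph (suc k)

{-# OPTIONS --safe #-}

-- If p_x(G) = 1 then the distance d from x is injective, because a set of
-- vertices at the same distance from x is an x-position set. Hence d is a
-- bijection onto {0, …, n}, and adjacency becomes d y and d z being consecutive.
-- Conversely, a path from an end of a path graph to z meets every vertex before
-- z, so position sets of that end are singletons. If p_x(G) = 1 for all x, then
-- every vertex has at most one neighbour, which leaves only K₁ and K₂.
module Submission where

open import Defs
open import Data.Fin using (Fin; zero; suc; toℕ; fromℕ<; punchOut)
open import Data.Fin.Properties
  using (any?; injective⇒≤; punchOut-injective; toℕ-fromℕ<; toℕ-injective)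
  renaming (_≟_ to _≟ᶠ_)
open import Data.Fin.Subset using (Subset; inside; outside; ∣_∣; _∈_; ⁅_⁆; _∪_)
open import Data.Fin.Subset.Properties
  using (nonempty?; Empty-unique; ∣⊥∣≡0; ∣⁅x⁆∣≡1; x∈⁅x⁆; x∈⁅y⁆⇒x≡y; x≢y⇒x∉⁅y⁆;
         p⊆q⇒∣p∣≤∣q∣; p⊂q⇒∣p∣<∣q∣; p⊆p∪q; q⊆p∪q; x∈p∪q⁻)
open import Data.List using (tabulate)
open import Data.List.Extrema.Nat using (max≤v⁺; v≤max⁺; min≤v⁺; v≤min⁺; max; min)
open import Data.List.Membership.Propositional using (lose) renaming (_∈_ to _∈ˡ_)
open import Data.List.Membership.Propositional.Properties
  using (∈-++⁺ˡ; ∈-++⁺ʳ; ∈-map⁺; ∈-filter⁺)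
open import Data.List.Relation.Unary.All.Properties using (map⁺; tabulate⁺; all-filter)
import Data.List.Relation.Unary.All as All
import Data.List.Relation.Unary.Any as ListAny
import Data.List.Relation.Unary.Any.Properties as ListAnyₚ
open import Data.Nat using (ℕ; zero; suc; _≤_; _<_; z≤n; s≤s; s≤s⁻¹)
open import Data.Nat.Induction using (<-rec)
open import Data.Nat.Properties
  using (≤-refl; ≤-reflexive; ≤-trans; ≤-antisym; ≤-total; m≤n⇒m≤1+n; n≮n; <⇒≱; ≮⇒≥; ≰⇒>;
         m≤n⇒m<n∨m≡n; anyUpTo?; _≤?_)
open import Data.Product using (_×_; _,_; proj₁; proj₂; ∃-syntax; Σ-syntax)
open import Data.Sum using (_⊎_; inj₁; inj₂; [_,_]′)
open import Data.Vec using (Vec; []; _∷_; head; last)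
open import Data.Vec.Membership.DecPropositional using () renaming (_∈?_ to ∈ᵛ-dec)
open import Data.Vec.Membership.Propositional using () renaming (_∈_ to _∈ᵛ_)
open import Data.Vec.Relation.Unary.All as VecAll using ([]; _∷_)
open import Data.Vec.Relation.Unary.AllPairs using ([]; _∷_)
open import Data.Vec.Relation.Unary.Any using (here; there)
open import Data.Vec.Relation.Unary.Linked using (Linked; [-]; _∷_)
open import Function using (_∘_; _⇔_; mk⇔; mk↔ₛ′; _↔_; Inverse; Equivalence)
open import Function.Construct.Identity using (↔-id)
open import Function.Definitions using (Injective)
open import Level using (0ℓ)
open import Relation.Binary.PropositionalEquality
  using (_≡_; _≢_; refl; sym; trans; cong; subst; ≢-sym)
open import Relation.Nullary using (¬_; Dec; yes; no; contradiction; _×-dec_)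
open import Relation.Unary using (Pred; Decidable)

-- Least witnesses, injections of finite sets and sizes of subsets.

leastWitness : ∀ {P : Pred ℕ 0ℓ} → Decidable P → ∀ k → P k →
               ∃[ m ] P m × (∀ l → P l → m ≤ l)
leastWitness {P} P? = <-rec _ step
  where
  step : ∀ k → (∀ {l} → l < k → P l → ∃[ m ] P m × (∀ l → P l → m ≤ l)) →
         P k → ∃[ m ] P m × (∀ l → P l → m ≤ l)
  step k rec pk with anyUpTo? P? k
  ... | yes (l , l<k , pl) = rec l<k pl
  ... | no none            = k , pk , λ l pl → ≮⇒≥ λ l<k → none (l , l<k , pl)

injective⇒surjective : ∀ {n} (f : Fin n → Fin n) → Injective _≡_ _≡_ f →
                       ∀ y → ∃[ x ] f x ≡ y
injective⇒surjective {suc n} f inj y with any? (λ x → f x ≟ᶠ y)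
... | yes preimage = preimage
-- Removing a missed value `y` from the codomain by `punchOut` would leave an injection from
-- `Fin (suc n)` into `Fin n`.
... | no  missed   = contradiction
  (injective⇒≤ {f = λ x → punchOut (y≢f x)} λ eq → inj (punchOut-injective (y≢f _) (y≢f _) eq))
  (n≮n n)
  where
  y≢f : ∀ x → y ≢ f x
  y≢f x eq = missed (x , sym eq)

injective⇒↔ : ∀ {n} (f : Fin n → Fin n) → Injective _≡_ _≡_ f → Fin n ↔ Fin n
injective⇒↔ f inj = mk↔ₛ′ f (proj₁ ∘ surj) (proj₂ ∘ surj) (λ x → inj (proj₂ (surj (f x))))
  where surj = injective⇒surjective f inj

subsets-complete : ∀ {n} (S : Subset n) → S ∈ˡ subsets n
subsets-complete []            = ListAny.here refl
subsets-complete (inside  ∷ S) = ∈-++⁺ˡ (∈-map⁺ (inside ∷_) (subsets-complete S))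
subsets-complete (outside ∷ S) =
  ∈-++⁺ʳ _ (∈-map⁺ (outside ∷_) (subsets-complete S))

∣S∣≤1 : ∀ {n} (S : Subset n) → (∀ {y z} → y ∈ S → z ∈ S → y ≡ z) → ∣ S ∣ ≤ 1
∣S∣≤1 {n} S unique with nonempty? S
... | no empty =
  subst (_≤ 1) (sym (trans (cong ∣_∣ (Empty-unique empty)) (∣⊥∣≡0 n))) z≤n
... | yes (y , y∈S) = subst (∣ S ∣ ≤_) (∣⁅x⁆∣≡1 y) (p⊆q⇒∣p∣≤∣q∣ S⊆⁅y⁆)
  where
  S⊆⁅y⁆ : ∀ {z} → z ∈ S → z ∈ ⁅ y ⁆
  S⊆⁅y⁆ z∈S = subst (_∈ ⁅ y ⁆) (unique y∈S z∈S) (x∈⁅x⁆ y)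

2≤∣pair∣ : ∀ {n} {y z : Fin n} → y ≢ z → 2 ≤ ∣ ⁅ y ⁆ ∪ ⁅ z ⁆ ∣
2≤∣pair∣ {y = y} {z} y≢z = subst (_< ∣ ⁅ y ⁆ ∪ ⁅ z ⁆ ∣) (∣⁅x⁆∣≡1 y)
  (p⊂q⇒∣p∣<∣q∣ (p⊆p∪q ⁅ z ⁆ , z , q⊆p∪q ⁅ y ⁆ ⁅ z ⁆ (x∈⁅x⁆ z) , x≢y⇒x∉⁅y⁆ (≢-sym y≢z)))

-- Elementary bounds on position numbers.

module _ {n : ℕ} (G : Graph n) where
  open Graph G

  position⇒≤ : ∀ {x S} → IsPositionSet G x S → ∣ S ∣ ≤ positionNumber G x
  position⇒≤ {x} {S} pos = v≤max⁺ 0 _ (inj₂ (lose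
    (∈-map⁺ ∣_∣ (∈-filter⁺ (isPositionSet? G x) (subsets-complete S) pos)) ≤-refl))

  positionNumber≤ : ∀ {x b} → (∀ S → IsPositionSet G x S → ∣ S ∣ ≤ b) →
                    positionNumber G x ≤ b
  -- `z≤n` bounds the default value 0 of the maximum.
  positionNumber≤ {x} bound = max≤v⁺ z≤n
    (map⁺ (All.map (bound _) (all-filter (isPositionSet? G x) (subsets n))))

  singleton-position : ∀ x y → IsPositionSet G x ⁅ y ⁆
  singleton-position x y a a∈ b b∈ b≢a =
    contradiction (trans (x∈⁅y⁆⇒x≡y y b∈) (sym (x∈⁅y⁆⇒x≡y y a∈))) b≢a

  1≤positionNumber : ∀ x → 1 ≤ positionNumber G x
  1≤positionNumber x =
    subst (_≤ positionNumber G x) (∣⁅x⁆∣≡1 x) (position⇒≤ (singleton-position x x))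

  -- Walks and their reduction to paths.

  Walk : ℕ → Fin n → Fin n → Set
  Walk zero    x y = x ≡ y
  Walk (suc k) x y = ∃[ w ] x ∼ w × Walk k w y

  walk? : ∀ k x y → Dec (Walk k x y)
  walk? zero    x y = x ≟ᶠ y
  walk? (suc k) x y = any? λ w → (x ∼? w) ×-dec walk? k w y

  walk-snoc : ∀ k {x y z} → Walk k x y → y ∼ z → Walk (suc k) x z
  walk-snoc zero    refl          y∼z = _ , y∼z , refl
  walk-snoc (suc k) (w , x∼w , p) y∼z = w , x∼w , walk-snoc k p y∼z

  walk-unsnoc : ∀ k {x z} → Walk (suc k) x z → ∃[ y ] Walk k x y × y ∼ z
  walk-unsnoc zero    (_ , x∼z , refl) = _ , refl , x∼z
  walk-unsnoc (suc k) (w , x∼w , p) =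
    let y , q , y∼z = walk-unsnoc k p in y , (w , x∼w , q) , y∼z

  linked⇒walk : ∀ {k} (v : Vec (Fin n) (suc k)) → Linked _∼_ v → Walk k (head v) (last v)
  linked⇒walk (x ∷ [])    [-]       = refl
  linked⇒walk (x ∷ y ∷ v) (x∼y ∷ l) = y , x∼y , linked⇒walk (y ∷ v) l

  path⇒walk : ∀ {k x y} {v : Vec (Fin n) (suc k)} → IsPath G x y v → Walk k x y
  path⇒walk (refl , refl , l , _) = linked⇒walk _ l

  -- Cutting at `z` loses at least one edge because `z` is not the last vertex. On a geodesic this
  -- puts every vertex before the end strictly closer to the start.
  walk-prefix : ∀ {k} (v : Vec (Fin n) (suc k)) → Linked _∼_ v →
                ∀ {z} → z ∈ᵛ v → z ≢ last v → ∃[ i ] i < k × Walk i (head v) z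
  walk-prefix (x ∷ [])    [-]       (here refl) z≢ = contradiction refl z≢
  walk-prefix (x ∷ y ∷ v) (x∼y ∷ l) (here refl) z≢ = 0 , s≤s z≤n , refl
  walk-prefix (x ∷ y ∷ v) (x∼y ∷ l) (there z∈)  z≢ =
    let i , i<k , p = walk-prefix (y ∷ v) l z∈ z≢ in suc i , s≤s i<k , y , x∼y , p

  path-suffix : ∀ {k x y z} (v : Vec (Fin n) (suc k)) → IsPath G x y v → z ∈ᵛ v →
                ∃[ l ] l ≤ k × Σ[ w ∈ Vec (Fin n) (suc l) ] IsPath G z y w
  path-suffix v (refl , last≡ , l , u) (here refl) = _ , ≤-refl , v , refl , last≡ , l , u
  path-suffix (x ∷ y ∷ v) (_ , last≡ , _ ∷ l , _ ∷ u) (there z∈) =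
    let m , m≤k , w , p = path-suffix (y ∷ v) (refl , last≡ , l , u) z∈
    in m , m≤n⇒m≤1+n m≤k , w , p

  notIn⇒All≢ : ∀ {k x} (v : Vec (Fin n) k) → ¬ x ∈ᵛ v → VecAll.All (x ≢_) v
  notIn⇒All≢ []      x∉ = []
  notIn⇒All≢ (y ∷ v) x∉ = (x∉ ∘ here) ∷ notIn⇒All≢ v (x∉ ∘ there)

  -- Loop erasure: if `x` recurs on the path obtained from the rest of the walk, the part of that
  -- path from `x` on is taken instead. Walks can be extended and cut freely, so distances are
  -- defined by them and turned into geodesics through this lemma.
  walk⇒path : ∀ k {x y} → Walk k x y →
              ∃[ l ] l ≤ k × Σ[ v ∈ Vec (Fin n) (suc l) ] IsPath G x y v
  walk⇒path zero    {x} refl = 0 , z≤n , x ∷ [] , refl , refl , [-] , ([] ∷ [])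
  walk⇒path (suc k) {x} (w , x∼w , p) with walk⇒path k p
  ... | l , l≤k , v@(_ ∷ _) , path@(refl , last≡ , link , u) with ∈ᵛ-dec _≟ᶠ_ x v
  ... | yes x∈v = let m , m≤l , q = path-suffix v path x∈v
                  in m , m≤n⇒m≤1+n (≤-trans m≤l l≤k) , q
  ... | no  x∉v = suc l , s≤s l≤k , x ∷ v , refl , last≡ , x∼w ∷ link , (notIn⇒All≢ v x∉v ∷ u)

  -- Distances from a fixed vertex.

  module _ (connected : Connected G) (x : Fin n) where

    shortestWalk : ∀ y → ∃[ k ] Walk k x y × (∀ l → Walk l x y → k ≤ l)
    shortestWalk y =
      let k , v , p = connected x y in leastWitness (λ k → walk? k x y) k (path⇒walk p)

    dist : Fin n → ℕ
    dist y = proj₁ (shortestWalk y)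

    dist-walk : ∀ y → Walk (dist y) x y
    dist-walk y = proj₁ (proj₂ (shortestWalk y))

    dist-least : ∀ {y} l → Walk l x y → dist y ≤ l
    dist-least {y} = proj₂ (proj₂ (shortestWalk y))

    -- Loop erasure cannot shorten a shortest walk, so the path it yields has length exactly
    -- `dist y`; no path is shorter, since every path is a walk.
    geodesic : ∀ y → Σ[ v ∈ Vec (Fin n) (suc (dist y)) ] IsGeodesic G x y v
    geodesic y with walk⇒path (dist y) (dist-walk y)
    ... | l , l≤d , v , p with ≤-antisym l≤d (dist-least l (path⇒walk p))
    ... | refl = v , p , λ w q → dist-least _ (path⇒walk q)

    geodesic-length≤ : ∀ {k y} {v : Vec (Fin n) (suc k)} → IsGeodesic G x y v → k ≤ dist y
    geodesic-length≤ {y = y} (_ , least) =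
      let w , p , _ = geodesic y in least w p

    dist<n : ∀ y → dist y < n
    dist<n y = let v , p , _ = geodesic y in path-length< G v p

    -- A vertex on a geodesic to `y`, other than `y` itself, is strictly closer to `x` than `y` is.
    equidistant⇒position : ∀ {S} → (∀ {y z} → y ∈ S → z ∈ S → dist y ≡ dist z) →
                           IsPositionSet G x S
    equidistant⇒position equi y y∈S z z∈S z≢y v g@((refl , refl , link , _) , _) z∈v =
      let i , i<k , p = walk-prefix v link z∈v z≢y
      in <⇒≱ i<k (≤-trans (geodesic-length≤ g)
           (≤-trans (≤-reflexive (equi y∈S z∈S)) (dist-least i p)))

    -- `x` lies on every geodesic that starts at `x`, so it blocks every other vertex.
    position-member : ∀ {S} → IsPositionSet G x S → x ∈ S → ∀ {z} → z ∈ S → x ≡ z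
    position-member pos x∈S {z} z∈S with x ≟ᶠ z
    ... | yes x≡z = x≡z
    ... | no  x≢z with geodesic z
    ...   | v@(_ ∷ _) , g@((refl , _) , _) =
      contradiction (here refl) (pos z z∈S x x∈S x≢z v g)

    -- Consequences of a position number at most 1.

    module _ (p≤1 : positionNumber G x ≤ 1) where

      -- Two distinct vertices at equal distance would form a position set of size 2.
      dist-injective : Injective _≡_ _≡_ dist
      dist-injective {y} {z} eq with y ≟ᶠ z
      ... | yes y≡z = y≡z
      ... | no  y≢z = contradiction
        (≤-trans (2≤∣pair∣ y≢z) (≤-trans (position⇒≤ (equidistant⇒position equi)) p≤1)) λ { (s≤s ()) }
        where
        dist≡ : ∀ {a} → a ∈ ⁅ y ⁆ ∪ ⁅ z ⁆ → dist a ≡ dist z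
        dist≡ a∈ with x∈p∪q⁻ ⁅ y ⁆ ⁅ z ⁆ a∈
        ... | inj₁ a∈y = trans (cong dist (x∈⁅y⁆⇒x≡y y a∈y)) eq
        ... | inj₂ a∈z = cong dist (x∈⁅y⁆⇒x≡y z a∈z)
        equi : ∀ {a b} → a ∈ ⁅ y ⁆ ∪ ⁅ z ⁆ → b ∈ ⁅ y ⁆ ∪ ⁅ z ⁆ → dist a ≡ dist b
        equi a∈ b∈ = trans (dist≡ a∈) (sym (dist≡ b∈))

      ∼⇒dist≤ : ∀ {y z} → y ∼ z → dist z ≤ suc (dist y)
      ∼⇒dist≤ {y} y∼z = dist-least _ (walk-snoc (dist y) (dist-walk y) y∼z)

      -- Distances change by at most one along an edge, and injectivity excludes equality.
      ∼⇒consecutive : ∀ {y z} → y ∼ z → dist z ≡ suc (dist y) ⊎ dist y ≡ suc (dist z)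
      ∼⇒consecutive y∼z with m≤n⇒m<n∨m≡n (∼⇒dist≤ y∼z)
      ... | inj₂ eq = inj₁ eq
      ... | inj₁ z<1+y with m≤n⇒m<n∨m≡n (s≤s⁻¹ z<1+y)
      ...   | inj₁ z<y = inj₂ (≤-antisym (∼⇒dist≤ (∼-sym y∼z)) z<y)
      ...   | inj₂ z≡y = contradiction y∼z (∼-irrefl (sym (dist-injective z≡y)))

      -- The vertex `w` before `z` on a shortest walk from `x` is at the same distance as `y`, so
      -- injectivity identifies the two.
      successor⇒∼ : ∀ {y z} → dist z ≡ suc (dist y) → y ∼ z
      successor⇒∼ {y} {z} eq with walk-unsnoc (dist y) (subst (λ k → Walk k x z) eq (dist-walk z))
      ... | w , p , w∼z = subst (_∼ z) (dist-injective w≡y) w∼z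
        where
        w≡y : dist w ≡ dist y
        w≡y = ≤-antisym (dist-least (dist y) p)
                        (s≤s⁻¹ (subst (_≤ suc (dist w)) eq (∼⇒dist≤ w∼z)))

      -- All neighbours of `x` are at distance 1.
      neighbour-unique : ∀ {y z} → x ∼ y → x ∼ z → y ≡ z
      neighbour-unique x∼y x∼z = dist-injective (trans (dist≡1 x∼y) (sym (dist≡1 x∼z)))
        where
        dist≡1 : ∀ {y} → x ∼ y → dist y ≡ 1
        dist≡1 {y} x∼y with dist y | dist-walk y | dist-least {y} 1 (y , x∼y , refl)
        ... | zero        | x≡y | _      = contradiction x∼y (∼-irrefl x≡y)
        ... | suc zero    | _   | _      = refl
        ... | suc (suc _) | _   | s≤s ()

      distIndex : Fin n → Fin n
      distIndex y = fromℕ< (dist<n y)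

      toℕ-distIndex : ∀ y → toℕ (distIndex y) ≡ dist y
      toℕ-distIndex y = toℕ-fromℕ< (dist<n y)

      -- The distances are `n` distinct numbers below `n`, so every value is attained; adjacency of
      -- vertices is consecutiveness of their distances.
      ≅pathGraph : G ≅ pathGraph n
      ≅pathGraph = injective⇒↔ distIndex index-injective , λ y z → mk⇔ (to y z) (from y z)
        where
        index-injective : Injective _≡_ _≡_ distIndex
        index-injective {y} {z} eq = dist-injective
          (trans (sym (toℕ-distIndex y)) (trans (cong toℕ eq) (toℕ-distIndex z)))
        to : ∀ y z → y ∼ z → Graph._∼_ (pathGraph n) (distIndex y) (distIndex z)
        to y z rewrite toℕ-distIndex y | toℕ-distIndex z = ∼⇒consecutive
        from : ∀ y z → Graph._∼_ (pathGraph n) (distIndex y) (distIndex z) → y ∼ z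
        from y z rewrite toℕ-distIndex y | toℕ-distIndex z =
          [ successor⇒∼ , ∼-sym ∘ successor⇒∼ ]′

  singletons⇒p≤1 : ∀ {x} → (∀ {S} → IsPositionSet G x S → ∀ {y z} → y ∈ S → z ∈ S → y ≡ z) →
                   positionNumber G x ≤ 1
  singletons⇒p≤1 unique = positionNumber≤ λ S pos → ∣S∣≤1 S (unique pos)

  -- When every vertex has at most one neighbour, the second step of a walk returns to its start, so
  -- a walk of length at least 2 is shortened by deleting two steps.
  shortest⇒∼ : (∀ {w y z} → w ∼ y → w ∼ z → y ≡ z) →
               ∀ k {x y} → x ≢ y → Walk k x y → (∀ l → Walk l x y → k ≤ l) → x ∼ y
  shortest⇒∼ unique zero       x≢y x≡y              least = contradiction x≡y x≢y
  shortest⇒∼ unique (suc zero) x≢y (_ , x∼y , refl) least = x∼y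
  shortest⇒∼ unique (suc (suc k)) {y = y} x≢y (w , x∼w , b , w∼b , p) least = contradiction
    (least k (subst (λ b → Walk k b y) (unique w∼b (∼-sym x∼w)) p))
    (<⇒≱ (s≤s (m≤n⇒m≤1+n ≤-refl)))

  p≤1⇒complete : Connected G → (∀ x → positionNumber G x ≤ 1) → ∀ {x y} → x ≢ y → x ∼ y
  p≤1⇒complete connected p≤1 {x} {y} x≢y =
    shortest⇒∼ (neighbour-unique connected _ (p≤1 _)) (dist connected x y) x≢y
      (dist-walk connected x y) (dist-least connected x)

  complete⇒≅ : (∀ {x y} → x ≢ y → x ∼ y) → G ≅ completeGraph n
  complete⇒≅ complete =
    ↔-id _ , λ x y → mk⇔ (λ x∼y x≡y → ∼-irrefl x≡y x∼y) complete

-- Graphs isomorphic to complete graphs.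

to-injective : ∀ {m n} (f : Fin m ↔ Fin n) → Injective _≡_ _≡_ (Inverse.to f)
to-injective f {y} {z} eq =
  trans (sym (Inverse.strictlyInverseʳ f y))
        (trans (cong (Inverse.from f) eq) (Inverse.strictlyInverseʳ f z))

≅complete⇒connected : ∀ {m n} (G : Graph n) → G ≅ completeGraph m → Connected G
≅complete⇒connected G (f , adj) x y with x ≟ᶠ y
... | yes x≡y = 0 , x ∷ [] , refl , x≡y , [-] , ([] ∷ [])
... | no  x≢y = 1 , x ∷ y ∷ [] , refl , refl ,
  Equivalence.from (adj x y) (x≢y ∘ to-injective f) ∷ [-] , ((x≢y ∷ []) ∷ [] ∷ [])

-- Graphs isomorphic to paths.

module _ {n m : ℕ} (G : Graph n) (iso : G ≅ pathGraph m) where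
  open Graph G
  private f = proj₁ iso

  index : Fin n → ℕ
  index y = toℕ (Inverse.to f y)

  index-injective : Injective _≡_ _≡_ index
  index-injective eq = to-injective f (toℕ-injective eq)

  -- This keeps a walk from jumping over an index as it rises.
  ∼⇒index≤ : ∀ {y z} → y ∼ z → index z ≤ suc (index y)
  ∼⇒index≤ {y} {z} y∼z with Equivalence.to (proj₂ iso y z) y∼z
  ... | inj₁ eq = ≤-reflexive eq
  ... | inj₂ eq = m≤n⇒m≤1+n (≤-trans (m≤n⇒m≤1+n ≤-refl) (≤-reflexive (sym eq)))

  -- A discrete intermediate value theorem along the path.
  between⇒∈ : ∀ {k} (v : Vec (Fin n) (suc k)) → Linked _∼_ v → ∀ y →
              index (head v) ≤ index y → index y ≤ index (last v) → y ∈ᵛ v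
  between⇒∈ (x ∷ [])    [-]       y x≤y y≤x = here (index-injective (≤-antisym y≤x x≤y))
  between⇒∈ (x ∷ w ∷ v) (x∼w ∷ l) y x≤y y≤z with m≤n⇒m<n∨m≡n x≤y
  ... | inj₁ x<y = there (between⇒∈ (w ∷ v) l y (≤-trans (∼⇒index≤ x∼w) x<y) y≤z)
  ... | inj₂ x≡y = here (index-injective (sym x≡y))

  -- A geodesic from `x` to `z` goes from index 0 to that of `z`, so it meets every `y` of smaller
  -- index, and no position set contains both `y` and `z`.
  end-positionNumber≤1 : Connected G → ∀ {x} → index x ≡ 0 → positionNumber G x ≤ 1
  end-positionNumber≤1 connected {x} x≡0 = singletons⇒p≤1 G λ pos {y} {z} y∈S z∈S →
    [ ordered pos y∈S z∈S , sym ∘ ordered pos z∈S y∈S ]′ (≤-total (index y) (index z))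
    where
    ordered : ∀ {S} → IsPositionSet G x S → ∀ {y z} → y ∈ S → z ∈ S →
              index y ≤ index z → y ≡ z
    ordered pos {y} {z} y∈S z∈S y≤z with y ≟ᶠ z
    ... | yes y≡z = y≡z
    ... | no  y≢z with geodesic G connected x z
    ...   | v , g@((head≡x , last≡z , link , _) , _) = contradiction
      (between⇒∈ v link y
        (subst (_≤ index y) (sym (trans (cong index head≡x) x≡0)) z≤n)
        (subst (λ z → index y ≤ index z) (sym last≡z) y≤z))
      (pos z z∈S y y∈S y≢z v g)

-- The hypothesis on `Fin m` says that it has at most two elements, in the form needed for the
-- images of `x`, `y` and `z`. If `x` is `y` or `z`, it belongs to the position set, which then has
-- no other member.
complete≤2-positionNumber≤1 :
  ∀ {m n} (G : Graph n) → G ≅ completeGraph m →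
  (∀ (a b c : Fin m) → a ≡ b ⊎ a ≡ c ⊎ b ≡ c) → ∀ x → positionNumber G x ≤ 1
complete≤2-positionNumber≤1 G iso@(f , _) coincide x = singletons⇒p≤1 G unique
  where
  connected = ≅complete⇒connected G iso
  unique : ∀ {S} → IsPositionSet G x S → ∀ {y z} → y ∈ S → z ∈ S → y ≡ z
  unique pos {y} {z} y∈S z∈S
    with coincide (Inverse.to f x) (Inverse.to f y) (Inverse.to f z)
  ... | inj₂ (inj₂ y≡z) = to-injective f y≡z
  ... | inj₁ x≡y with to-injective f x≡y
  ...   | refl = position-member G connected x pos y∈S z∈S
  unique pos {y} {z} y∈S z∈S | inj₂ (inj₁ x≡z) with to-injective f x≡z
  ...   | refl = sym (position-member G connected x pos z∈S y∈S)

coincide₁ : ∀ (a b c : Fin 1) → a ≡ b ⊎ a ≡ c ⊎ b ≡ c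
coincide₁ zero zero _ = inj₁ refl

coincide₂ : ∀ (a b c : Fin 2) → a ≡ b ⊎ a ≡ c ⊎ b ≡ c
coincide₂ zero       zero       _          = inj₁ refl
coincide₂ zero       (suc zero) zero       = inj₂ (inj₁ refl)
coincide₂ zero       (suc zero) (suc zero) = inj₂ (inj₂ refl)
coincide₂ (suc zero) zero       zero       = inj₂ (inj₂ refl)
coincide₂ (suc zero) zero       (suc zero) = inj₂ (inj₁ refl)
coincide₂ (suc zero) (suc zero) _          = inj₁ refl

-- Maximum and minimum of a function on `Fin (suc n)`.

module _ {n : ℕ} (f : Fin (suc n) → ℕ) where

  f≤max : ∀ x → f x ≤ max (f zero) (tabulate f)
  f≤max x = v≤max⁺ (f zero) (tabulate f) (inj₂ (ListAnyₚ.tabulate⁺ {f = f} x ≤-refl))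

  max≤ : ∀ {b} → (∀ x → f x ≤ b) → max (f zero) (tabulate f) ≤ b
  max≤ f≤b = max≤v⁺ (f≤b zero) (tabulate⁺ f≤b)

  min≤f : ∀ x → min (f zero) (tabulate f) ≤ f x
  min≤f x = min≤v⁺ (f zero) (tabulate f) (inj₂ (ListAnyₚ.tabulate⁺ {f = f} x ≤-refl))

  ≤min : ∀ {b} → (∀ x → b ≤ f x) → b ≤ min (f zero) (tabulate f)
  ≤min b≤f = v≤min⁺ (b≤f zero) (tabulate⁺ b≤f)

  -- If all values exceeded `b`, so would their minimum.
  min-attains≤ : ∀ {b} → min (f zero) (tabulate f) ≤ b → ∃[ x ] f x ≤ b
  min-attains≤ {b} min≤b with any? (λ x → f x ≤? b)
  ... | yes found = found
  ... | no  none  = contradiction min≤b (<⇒≱ (≤min λ x → ≰⇒> λ fx≤b → none (x , fx≤b)))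

-- From position numbers to `vp` and `vp⁻`.

module _ {n : ℕ} (G : Graph (suc n)) where

  p≤vp : ∀ x → positionNumber G x ≤ vp G
  p≤vp = f≤max (positionNumber G)

  p≤1⇒vp≡1 : (∀ x → positionNumber G x ≤ 1) → vp G ≡ 1
  p≤1⇒vp≡1 p≤1 = ≤-antisym (max≤ (positionNumber G) p≤1)
                           (≤-trans (1≤positionNumber G zero) (p≤vp zero))

  p≤1⇒vp⁻≡1 : ∀ x → positionNumber G x ≤ 1 → vp⁻ G ≡ 1
  p≤1⇒vp⁻≡1 x p≤1 = ≤-antisym (≤-trans (min≤f (positionNumber G) x) p≤1)
                              (≤min (positionNumber G) (1≤positionNumber G))

  vp⁻≡1⇒p≤1 : vp⁻ G ≡ 1 → ∃[ x ] positionNumber G x ≤ 1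
  vp⁻≡1⇒p≤1 eq = min-attains≤ (positionNumber G) (≤-reflexive eq)

p≤1⇒K₁⊎K₂ : ∀ n (G : Graph (suc n)) → Connected G → (∀ x → positionNumber G x ≤ 1) →
            G ≅ completeGraph 1 ⊎ G ≅ completeGraph 2
p≤1⇒K₁⊎K₂ zero          G c p≤1 = inj₁ (complete⇒≅ G (p≤1⇒complete G c p≤1))
p≤1⇒K₁⊎K₂ (suc zero)    G c p≤1 = inj₂ (complete⇒≅ G (p≤1⇒complete G c p≤1))
-- On three or more vertices, completeness would give `zero` two distinct neighbours.
p≤1⇒K₁⊎K₂ (suc (suc _)) G c p≤1 = contradiction
  (neighbour-unique G c zero (p≤1 zero)
    (p≤1⇒complete G c p≤1 {zero} {suc zero} λ ())
    (p≤1⇒complete G c p≤1 {zero} {suc (suc zero)} λ ()))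
  λ ()

corollary2p7 : (∀ (n : ℕ) (G : Graph (suc n)) → Connected G → (vp⁻ G ≡ 1 ⇔ IsPathGraph G))
    × (∀ (n : ℕ) (G : Graph (suc n)) → ((Connected G × vp G ≡ 1) ⇔ (G ≅ completeGraph 1 ⊎ G ≅ completeGraph 2)))
corollary2p7 =
  (λ n G connected → mk⇔
    -- `G` has `suc n` vertices, hence the witness `n` for `pathGraph (suc n)`.
    (λ vp⁻≡1 → let x , p≤1 = vp⁻≡1⇒p≤1 G vp⁻≡1 in n , ≅pathGraph G connected x p≤1)
    -- The vertex that `f` sends to the end `zero` of the path has position number at most 1.
    (λ (k , iso@(f , _)) → p≤1⇒vp⁻≡1 G (Inverse.from f zero)
      (end-positionNumber≤1 G iso connected (cong toℕ (Inverse.strictlyInverseˡ f zero)))))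
  , λ n G → mk⇔
    (λ (connected , vp≡1) → p≤1⇒K₁⊎K₂ n G connected
      λ x → subst (positionNumber G x ≤_) vp≡1 (p≤vp G x))
    [ (λ iso → ≅complete⇒connected G iso
             , p≤1⇒vp≡1 G (complete≤2-positionNumber≤1 G iso coincide₁))
    , (λ iso → ≅complete⇒connected G iso
             , p≤1⇒vp≡1 G (complete≤2-positionNumber≤1 G iso coincide₂)) ]′
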